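{- For every integer $k\ge 2$ and every positive integer $n$, \[ \mathrm{ex}_3\big(n, C^{(3)}_{2k}\big)\le t_{2k}(n)+\mathrm{ex}(n,C_{2k}). \]
   Context: A Berge cycle of length $m$ in a hypergraph is a family of $m$ distinct hyperedges $H_0,\dots,H_{m-1}$ for which there exist distinct vertices $v_0,\dots,v_{m-1}$ with $\{v_i,v_{i+1}\}\subset H_i$ for $0\le i\le m-1$ (indices mod $m$). $\mathrm{ex}_3(n,C^{(3)}_m)$ is the maximum number of hyperedges in a 3-uniform hypergraph on $n$ vertices with no Berge cycle of length $m$. $\mathrm{ex}(n,C_{2k})$ is the maximum number of edges of a simple graph on $n$ vertices with no cycle of length $2k$. $t_\ell(n)$ is the maximum number of triangles in a simple graph on $n$ vertices containing no cycle of length $\ell$. -}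

module Defs where

open import Data.Bool.Properties using () renaming (_≟_ to _≟ᵇ_)
open import Data.Fin using (Fin; zero; suc; toℕ)
open import Data.Fin.Properties using (all?; any?; injective⇒≤) renaming (_≟_ to _≟ᶠ_)
open import Data.Fin.Subset using (Subset; inside; outside; ∣_∣; ⁅_⁆; _∪_; _⊆_; _∈_)
open import Data.Fin.Subset.Properties using (anySubset?; _⊆?_; _∈?_)
open import Data.List using (List; []; _∷_; _++_; length; lookup; map; filter; cartesianProductWith)
open import Data.List.Extrema.Nat using (argmax; argmax-all; f[xs]≤f[argmax])
open import Data.List.Membership.Propositional using () renaming (_∈_ to _∈ˡ_)
open import Data.List.Membership.Propositional.Properties
  using (∈-map⁺; ∈-map⁻; ∈-++⁺ˡ; ∈-++⁺ʳ; ∈-cartesianProductWith⁺; ∈-filter⁺; ∈-lookup)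
open import Data.List.Membership.Setoid.Properties using (index-injective)
open import Data.List.Relation.Unary.All as All using (All; []; _∷_)
open import Data.List.Relation.Unary.All.Properties using (all-filter)
open import Data.List.Relation.Unary.AllPairs using ([]; _∷_)
open import Data.List.Relation.Unary.Any using (here; there; index)
open import Data.List.Relation.Unary.Unique.Propositional using (Unique)
open import Data.List.Relation.Unary.Unique.Propositional.Properties using (map⁺; ++⁺)
open import Data.Nat using (ℕ; zero; suc; _≤_; z≤n; s≤s; _≟_; _≤?_)
open import Data.Nat.DivMod using (_mod_)
open import Data.Product using (∃; _×_; _,_; proj₁; proj₂)
open import Data.Vec using ([]; _∷_)
open import Data.Vec.Functional using () renaming (_∷_ to _◂_)
open import Data.Vec.Properties using (∷-injectiveʳ; ≡-dec)
open import Function using (_∘_; Injective)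
open import Relation.Binary.Definitions using (DecidableEquality)
open import Relation.Binary.PropositionalEquality
  using (_≡_; _≢_; _≗_; refl; sym; trans; cong; cong₂; subst; setoid)
open import Relation.Nullary using (¬_; Dec; yes; no; ¬?; contradiction)
open import Relation.Nullary.Decidable using (map′; _×-dec_; _→-dec_)
open import Relation.Unary using (Decidable)
import Data.List.Membership.DecPropositional as DecMembership
import Data.List.Relation.Unary.Unique.DecPropositional as DecUnique

_≟ˢ_ : ∀ {n} → DecidableEquality (Subset n)
_≟ˢ_ = ≡-dec _≟ᵇ_

-- The vertex set is Fin n.  The edge set is a duplicate-free list, so its
-- length is the number of edges; the order of the list is irrelevant to
-- every notion below.
record Hypergraph (r n : ℕ) : Set where
  field
    edges    : List (Subset n)
    uniform  : All (λ e → ∣ e ∣ ≡ r) edges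
    distinct : Unique edges

open Hypergraph public

Graph : ℕ → Set
Graph = Hypergraph 2

pair : ∀ {n} → Fin n → Fin n → Subset n
pair x y = ⁅ x ⁆ ∪ ⁅ y ⁆

-- i ↦ i + 1 (mod m)
next : ∀ {m} → Fin m → Fin m
next {suc m} i = suc (toℕ i) mod suc m

-- The requirement 1 ≤ m excludes the vacuous cycle of length 0.
record IsBergeCycle {n} (m : ℕ) (E : List (Subset n))
                    (v : Fin m → Fin n) (h : Fin m → Subset n) : Set where
  field
    positive          : 1 ≤ m
    vertices-distinct : Injective _≡_ _≡_ v
    edges-distinct    : Injective _≡_ _≡_ h
    edge              : ∀ i → h i ∈ˡ E
    incident          : ∀ i → pair (v i) (v (next i)) ⊆ h i

HasBergeCycle : ∀ {n} → ℕ → List (Subset n) → Set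
HasBergeCycle m E = ∃ λ v → ∃ λ h → IsBergeCycle m E v h

record IsCycle {n} (m : ℕ) (E : List (Subset n)) (v : Fin m → Fin n) : Set where
  field
    atLeast3          : 3 ≤ m
    vertices-distinct : Injective _≡_ _≡_ v
    adjacent          : ∀ i → pair (v i) (v (next i)) ∈ˡ E

HasCycle : ∀ {n} → ℕ → List (Subset n) → Set
HasCycle m E = ∃ λ v → IsCycle m E v

IsTriangle : ∀ {n} → List (Subset n) → Subset n → Set
IsTriangle E T = ∣ T ∣ ≡ 3 × (∀ x y → x ∈ T → y ∈ T → x ≢ y → pair x y ∈ˡ E)

isTriangle? : ∀ {n} (E : List (Subset n)) → Decidable (IsTriangle E)
isTriangle? E T = (∣ T ∣ ≟ 3) ×-dec
  all? λ x → all? λ y →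
    (x ∈? T) →-dec (y ∈? T) →-dec ¬? (x ≟ᶠ y) →-dec (pair x y ∈ˡ? E)
  where open DecMembership _≟ˢ_ using () renaming (_∈?_ to _∈ˡ?_)

subsets : ∀ n → List (Subset n)
subsets zero    = [] ∷ []
subsets (suc n) = map (inside ∷_) (subsets n) ++ map (outside ∷_) (subsets n)

subsets-complete : ∀ {n} (s : Subset n) → s ∈ˡ subsets n
subsets-complete []            = here refl
subsets-complete (inside  ∷ s) = ∈-++⁺ˡ (∈-map⁺ (inside ∷_) (subsets-complete s))
subsets-complete (outside ∷ s) = ∈-++⁺ʳ _ (∈-map⁺ (outside ∷_) (subsets-complete s))

subsets-unique : ∀ n → Unique (subsets n)
subsets-unique zero    = [] ∷ []
subsets-unique (suc n) = ++⁺ (map⁺ ∷-injectiveʳ (subsets-unique n))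
                             (map⁺ ∷-injectiveʳ (subsets-unique n))
                             disjoint
  where
  disjoint : ∀ {s} → ¬ (s ∈ˡ map (inside ∷_) (subsets n) × s ∈ˡ map (outside ∷_) (subsets n))
  disjoint (p , q) with ∈-map⁻ (inside ∷_) p | ∈-map⁻ (outside ∷_) q
  ... | _ , _ , refl | _ , _ , ()

triangleCount : ∀ {n} → List (Subset n) → ℕ
triangleCount E = length (filter (isTriangle? E) (subsets _))

IsMaximum : {A : Set} (P : A → Set) (f : A → ℕ) → ℕ → Set
IsMaximum P f m = (∃ λ x → P x × f x ≡ m) × (∀ x → P x → f x ≤ m)

-- Every extremal quantity below is a maximum over a finite, nonempty,
-- decidable family of edge sets, hence exists constructively.

private
  injective? : ∀ {m} {A : Set} → DecidableEquality A →
               (f : Fin m → A) → Dec (Injective _≡_ _≡_ f)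
  injective? _≟ᴬ_ f = map′ (λ p {i} {j} → p i j) (λ p i j → p)
    (all? λ i → all? λ j → (f i ≟ᴬ f j) →-dec (i ≟ᶠ j))

  injective-resp : ∀ {m} {A : Set} {f g : Fin m → A} → f ≗ g →
                   Injective _≡_ _≡_ f → Injective _≡_ _≡_ g
  injective-resp f≗g inj eq = inj (trans (f≗g _) (trans eq (sym (f≗g _))))

  anyFunction? : {A : Set} → (∀ {Q : A → Set} → Decidable Q → Dec (∃ Q)) →
                 ∀ m {P : (Fin m → A) → Set} → (∀ {f g} → f ≗ g → P f → P g) →
                 Decidable P → Dec (∃ P)
  anyFunction? {A} any zero resp P? =
    map′ (λ p → empty , p) (λ (f , p) → resp (λ ()) p) (P? empty)
    where
    empty : Fin 0 → A
    empty ()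
  anyFunction? any (suc m) {P} resp P? =
    map′ (λ (a , f , p) → (a ◂ f) , p)
         (λ (f , p) → f zero , f ∘ suc , resp (η f) p)
         (any λ a → anyFunction? any m (λ f≗g → resp (◂-cong f≗g)) λ f → P? (a ◂ f))
    where
    η : ∀ f → f ≗ (f zero ◂ f ∘ suc)
    η f zero    = refl
    η f (suc i) = refl
    ◂-cong : ∀ {a f g} → f ≗ g → (a ◂ f) ≗ (a ◂ g)
    ◂-cong f≗g zero    = refl
    ◂-cong f≗g (suc i) = f≗g i

  module _ {n m : ℕ} (E : List (Subset n)) where
    open DecMembership (_≟ˢ_ {n}) using () renaming (_∈?_ to _∈ˡ?_)

    isBergeCycle? : ∀ v h → Dec (IsBergeCycle m E v h)
    isBergeCycle? v h = map′ to from
      ((1 ≤? m) ×-dec injective? _≟ᶠ_ v ×-dec injective? _≟ˢ_ h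
        ×-dec all? (λ i → h i ∈ˡ? E)
        ×-dec all? (λ i → pair (v i) (v (next i)) ⊆? h i))
      where
      Fields : Set
      Fields = 1 ≤ m × Injective _≡_ _≡_ v × Injective _≡_ _≡_ h
             × (∀ i → h i ∈ˡ E) × (∀ i → pair (v i) (v (next i)) ⊆ h i)
      to : Fields → IsBergeCycle m E v h
      to (a , b , c , d , e) = record { positive = a ; vertices-distinct = b
        ; edges-distinct = c ; edge = d ; incident = e }
      from : IsBergeCycle m E v h → Fields
      from c = let open IsBergeCycle c in
        positive , vertices-distinct , edges-distinct , edge , incident

    isBergeCycle-resp : ∀ {v v′ h h′} → v ≗ v′ → h ≗ h′ →
                        IsBergeCycle m E v h → IsBergeCycle m E v′ h′
    isBergeCycle-resp v≗ h≗ c = let open IsBergeCycle c in record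
      { positive          = positive
      ; vertices-distinct = injective-resp v≗ vertices-distinct
      ; edges-distinct    = injective-resp h≗ edges-distinct
      ; edge              = λ i → subst (_∈ˡ E) (h≗ i) (edge i)
      ; incident          = λ i → subst (_ ∈_) (h≗ i) ∘ incident i
                                ∘ subst (_ ∈_) (sym (cong₂ pair (v≗ i) (v≗ (next i))))
      }

    isCycle? : ∀ v → Dec (IsCycle m E v)
    isCycle? v = map′ to from
      ((3 ≤? m) ×-dec injective? _≟ᶠ_ v ×-dec all? (λ i → pair (v i) (v (next i)) ∈ˡ? E))
      where
      Fields : Set
      Fields = 3 ≤ m × Injective _≡_ _≡_ v × (∀ i → pair (v i) (v (next i)) ∈ˡ E)
      to : Fields → IsCycle m E v
      to (a , b , c) = record { atLeast3 = a ; vertices-distinct = b ; adjacent = c }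
      from : IsCycle m E v → Fields
      from c = let open IsCycle c in atLeast3 , vertices-distinct , adjacent

    isCycle-resp : ∀ {v v′} → v ≗ v′ → IsCycle m E v → IsCycle m E v′
    isCycle-resp v≗ c = let open IsCycle c in record
      { atLeast3          = atLeast3
      ; vertices-distinct = injective-resp v≗ vertices-distinct
      ; adjacent          = λ i → subst (_∈ˡ E) (cong₂ pair (v≗ i) (v≗ (next i))) (adjacent i)
      }

hasBergeCycle? : ∀ {n} m (E : List (Subset n)) → Dec (HasBergeCycle m E)
hasBergeCycle? m E =
  anyFunction? any? m (λ v≗ (h , c) → h , isBergeCycle-resp E v≗ (λ _ → refl) c) λ v →
    anyFunction? anySubset? m (λ h≗ → isBergeCycle-resp E (λ _ → refl) h≗) (isBergeCycle? E v)

hasCycle? : ∀ {n} m (E : List (Subset n)) → Dec (HasCycle m E)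
hasCycle? m E = anyFunction? any? m (isCycle-resp E) (isCycle? E)

noBergeCycle-[] : ∀ {n} m → ¬ HasBergeCycle {n} m []
noBergeCycle-[] zero    (_ , _ , c) with IsBergeCycle.positive c
... | ()
noBergeCycle-[] (suc m) (_ , _ , c) with IsBergeCycle.edge c zero
... | ()

noCycle-[] : ∀ {n} m → ¬ HasCycle {n} m []
noCycle-[] zero    (_ , c) with IsCycle.atLeast3 c
... | ()
noCycle-[] (suc m) (_ , c) with IsCycle.adjacent c zero
... | ()

private
  unique-lookup-injective : {A : Set} {xs : List A} → Unique xs →
                            Injective _≡_ _≡_ (lookup xs)
  unique-lookup-injective (_ ∷ _)  {zero}  {zero}  _  = refl
  unique-lookup-injective (p ∷ _)  {zero}  {suc j} eq =
    contradiction eq (All.lookup p (∈-lookup j))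
  unique-lookup-injective (p ∷ _)  {suc i} {zero}  eq =
    contradiction (sym eq) (All.lookup p (∈-lookup i))
  unique-lookup-injective (_ ∷ ps) {suc i} {suc j} eq =
    cong suc (unique-lookup-injective ps eq)

  unique-length : ∀ {n} {es : List (Subset n)} → Unique es → length es ≤ length (subsets n)
  unique-length {es = es} u = injective⇒≤
    {f = λ i → index (subsets-complete (lookup es i))}
    λ eq → unique-lookup-injective u (index-injective (setoid _) _ _ eq)

  listsUpTo : {A : Set} → ℕ → List A → List (List A)
  listsUpTo zero    xs = [] ∷ []
  listsUpTo (suc l) xs = [] ∷ cartesianProductWith _∷_ xs (listsUpTo l xs)

  listsUpTo-complete : {A : Set} {xs : List A} → (∀ x → x ∈ˡ xs) →
                       ∀ {l} ys → length ys ≤ l → ys ∈ˡ listsUpTo l xs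
  listsUpTo-complete all {zero}  []       _       = here refl
  listsUpTo-complete all {suc l} []       _       = here refl
  listsUpTo-complete all {suc l} (y ∷ ys) (s≤s p) =
    there (∈-cartesianProductWith⁺ _∷_ (all y) (listsUpTo-complete all ys p))

abstract
  maximum-exists : ∀ r n {P : List (Subset n) → Set} → Decidable P → P [] →
                   (f : List (Subset n) → ℕ) →
                   ∃ (IsMaximum {Hypergraph r n} (P ∘ edges) (f ∘ edges))
  maximum-exists r n {P} P? P[] f =
    f best , (hypergraph , proj₂ (proj₂ best-valid) , refl) , bound
    where
    Valid : List (Subset n) → Set
    Valid es = All (λ e → ∣ e ∣ ≡ r) es × Unique es × P es

    valid? : Decidable Valid
    valid? es = All.all? (λ e → ∣ e ∣ ≟ r) es ×-dec DecUnique.unique? _≟ˢ_ es ×-dec P? es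

    candidates : List (List (Subset n))
    candidates = filter valid? (listsUpTo (length (subsets n)) (subsets n))

    best : List (Subset n)
    best = argmax f [] candidates

    best-valid : Valid best
    best-valid = argmax-all f {P = Valid} ([] , [] , P[])
      (all-filter valid? (listsUpTo (length (subsets n)) (subsets n)))

    hypergraph : Hypergraph r n
    hypergraph = record
      { edges = best ; uniform = proj₁ best-valid ; distinct = proj₁ (proj₂ best-valid) }

    bound : ∀ (H : Hypergraph r n) → P (edges H) → f (edges H) ≤ f best
    bound H p = All.lookup (f[xs]≤f[argmax] [] candidates)
      (∈-filter⁺ valid?
        (listsUpTo-complete subsets-complete (edges H) (unique-length (distinct H)))
        (uniform H , distinct H , p))

private
  ex₃-exists : ∀ n m → ∃ (IsMaximum {Hypergraph 3 n} (λ H → ¬ HasBergeCycle m (edges H))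
                                                     (λ H → length (edges H)))
  ex₃-exists n m = maximum-exists 3 n (¬? ∘ hasBergeCycle? m) (noBergeCycle-[] m) length

  ex-exists : ∀ n m → ∃ (IsMaximum {Graph n} (λ G → ¬ HasCycle m (edges G))
                                             (λ G → length (edges G)))
  ex-exists n m = maximum-exists 2 n (¬? ∘ hasCycle? m) (noCycle-[] m) length

  t-exists : ∀ l n → ∃ (IsMaximum {Graph n} (λ G → ¬ HasCycle l (edges G))
                                            (λ G → triangleCount (edges G)))
  t-exists l n = maximum-exists 2 n (¬? ∘ hasCycle? l) (noCycle-[] l) triangleCount

ex₃ : (n m : ℕ) → ℕ
ex₃ n m = proj₁ (ex₃-exists n m)

ex₃-isMaximum : ∀ n m → IsMaximum {Hypergraph 3 n} (λ H → ¬ HasBergeCycle m (edges H))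
                                                   (λ H → length (edges H)) (ex₃ n m)
ex₃-isMaximum n m = proj₂ (ex₃-exists n m)

ex : (n m : ℕ) → ℕ
ex n m = proj₁ (ex-exists n m)

ex-isMaximum : ∀ n m → IsMaximum {Graph n} (λ G → ¬ HasCycle m (edges G))
                                           (λ G → length (edges G)) (ex n m)
ex-isMaximum n m = proj₂ (ex-exists n m)

t : (l n : ℕ) → ℕ
t l n = proj₁ (t-exists l n)

t-isMaximum : ∀ l n → IsMaximum {Graph n} (λ G → ¬ HasCycle l (edges G))
                                          (λ G → triangleCount (edges G)) (t l n)
t-isMaximum l n = proj₂ (t-exists l n)

{-# OPTIONS --safe #-}
-- Go through the hyperedges one at a time, matching each to a pair of its
-- vertices not used so far, if there is one.  The matched pairs form a graph G.
-- A cycle in G becomes a Berge cycle on replacing each of its edges by the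
-- hyperedge matched to it, and an unmatched hyperedge is a triangle of G.
-- Hence the matched hyperedges number at most ex and the unmatched ones at most t.
module Submission where

open import Defs
open import Data.Fin using (Fin; zero; suc; toℕ)
open import Data.Fin.Properties using (any?; toℕ<n; toℕ-fromℕ<) renaming (_≟_ to _≟ᶠ_)
open import Data.Fin.Subset using (Subset; ∣_∣; ⁅_⁆; _∈_) renaming (_⊆_ to _⊆ˢ_)
open import Data.Fin.Subset.Properties
  using (_∈?_; ∣⁅x⁆∣≡1; ∪-identityˡ; ∪-identityʳ; x∈⁅x⁆; x∈⁅y⁆⇒x≡y; x∈p∪q⁺; x∈p∪q⁻)
open import Data.List using (List; []; _∷_; _++_; length; map)
open import Data.List.Membership.Propositional using (_∉_) renaming (_∈_ to _∈ˡ_)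
open import Data.List.Membership.Propositional.Properties
  using (∈-map⁺; ∈-map⁻; ∈-∃++; ∈-filter⁺)
open import Data.List.Relation.Binary.Permutation.Propositional.Properties
  using (shift; ↭-length; ∈-resp-↭)
open import Data.List.Relation.Binary.Sublist.Propositional
  using ([]; _∷_; _∷ʳ_; lookup) renaming (_⊆_ to _⊆ˡ_)
open import Data.List.Relation.Binary.Sublist.Propositional.Properties using (All-resp-⊆)
open import Data.List.Relation.Unary.All as All using (All; []; _∷_)
open import Data.List.Relation.Unary.All.Properties using (¬Any⇒All¬)
open import Data.List.Relation.Unary.AllPairs using (AllPairs; []; _∷_)
open import Data.List.Relation.Unary.Any using (here; there)
open import Data.List.Relation.Unary.Unique.Propositional using (Unique)
open import Data.Nat using (ℕ; suc; _+_; _*_; _≤_; z≤n; s≤s)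
open import Data.Nat.DivMod using (_%_; m%n<n; m<n⇒m%n≡m; n%n≡0)
open import Data.Nat.Properties
  using (+-suc; +-mono-≤; ≤-trans; m≤n⇒m<n∨m≡n)
open import Data.Product using (∃; _×_; _,_; proj₁; proj₂)
open import Data.Sum using (_⊎_; inj₁; inj₂; [_,_])
open import Function using (_∘_; Injective)
open import Relation.Binary using (Rel)
open import Relation.Binary.PropositionalEquality
  using (_≡_; _≢_; refl; sym; trans; cong; subst)
open import Relation.Nullary using (Dec; yes; no; ¬?; contradiction)
open import Relation.Nullary.Decidable using (_×-dec_; decidable-stable)
import Data.List.Membership.DecPropositional as DecMembership

module _ {A : Set} where

  AllPairs-resp-⊆ : ∀ {ℓ} {R : Rel A ℓ} {xs ys} → xs ⊆ˡ ys → AllPairs R ys → AllPairs R xs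
  AllPairs-resp-⊆ []         []       = []
  AllPairs-resp-⊆ (_ ∷ʳ p)   (_ ∷ rs) = AllPairs-resp-⊆ p rs
  AllPairs-resp-⊆ (refl ∷ p) (r ∷ rs) = All-resp-⊆ p r ∷ AllPairs-resp-⊆ p rs

  -- Induction on `xs`: the head is cut out of `ys`, and the tail, which avoids the head, still lies
  -- in what remains.
  unique⇒length-mono : ∀ {xs ys : List A} → Unique xs →
                       (∀ {x} → x ∈ˡ xs → x ∈ˡ ys) → length xs ≤ length ys
  unique⇒length-mono []         _   = z≤n
  unique⇒length-mono (x∉ ∷ xs!) sub with ∈-∃++ (sub (here refl))
  ... | as , bs , refl = subst (_ ≤_) (sym (↭-length (shift _ as bs)))
    (s≤s (unique⇒length-mono xs! sub′))
    where
    sub′ : ∀ {y} → y ∈ˡ _ → y ∈ˡ as ++ bs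
    sub′ y∈ with ∈-resp-↭ (shift _ as bs) (sub (there y∈))
    ... | here refl = contradiction refl (All.lookup x∉ y∈)
    ... | there y∈′ = y∈′

  -- Applied with `proj₁` to a matching: a hyperedge occurs in it at most once and so determines its
  -- pair.
  unique-map⇒injective : ∀ {B : Set} (f : A → B) {xs x y} → Unique (map f xs) →
                         x ∈ˡ xs → y ∈ˡ xs → f x ≡ f y → x ≡ y
  unique-map⇒injective f _        (here refl) (here refl) _  = refl
  unique-map⇒injective f (n ∷ _)  (here refl) (there y∈)  eq =
    contradiction eq (All.lookup n (∈-map⁺ f y∈))
  unique-map⇒injective f (n ∷ _)  (there x∈)  (here refl) eq =
    contradiction (sym eq) (All.lookup n (∈-map⁺ f x∈))
  unique-map⇒injective f (_ ∷ us) (there x∈)  (there y∈)  eq =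
    unique-map⇒injective f us x∈ y∈ eq

-- Separates the wraparound at `m` from the ordinary step, so that no remainders occur afterwards.
toℕ-next : ∀ {m} (i : Fin m) →
           toℕ (next i) ≡ suc (toℕ i) ⊎ (toℕ (next i) ≡ 0 × suc (toℕ i) ≡ m)
toℕ-next {suc m} i with m≤n⇒m<n∨m≡n (toℕ<n i)
... | inj₁ lt = inj₁ (trans (toℕ-fromℕ< (m%n<n (suc (toℕ i)) (suc m))) (m<n⇒m%n≡m lt))
... | inj₂ eq = inj₂ (trans (toℕ-fromℕ< (m%n<n (suc (toℕ i)) (suc m)))
                       (trans (cong (_% suc m) eq) (n%n≡0 (suc m))) , eq)

-- A return after two steps cannot happen without wrapping around; with one wrap it forces `m` to be
-- 2, and with two wraps 1.
next∘next≢id : ∀ {m} → 3 ≤ m → (i : Fin m) → next (next i) ≢ i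
next∘next≢id 3≤m i eq with toℕ-next i | toℕ-next (next i)
-- With `next (next i)` replaced by `i`, only two numbers are left; generalising them lets the
-- equations be matched with `refl`.
... | p | q rewrite eq with toℕ (next i) | toℕ i
next∘next≢id _ _ _ | inj₁ refl | inj₁ ()  | _ | _
next∘next≢id (s≤s (s≤s ())) _ _ | inj₁ refl | inj₂ (refl , refl) | _ | _
next∘next≢id (s≤s (s≤s ())) _ _ | inj₂ (refl , refl) | inj₁ refl | _ | _
next∘next≢id (s≤s ()) _ _ | inj₂ (refl , refl) | inj₂ (refl , _) | _ | _

module _ {n : ℕ} where

  ∈-pair⁻ : ∀ {x y z : Fin n} → z ∈ pair x y → z ≡ x ⊎ z ≡ y
  ∈-pair⁻ {x} {y} z∈ =
    [ inj₁ ∘ x∈⁅y⁆⇒x≡y x , inj₂ ∘ x∈⁅y⁆⇒x≡y y ] (x∈p∪q⁻ ⁅ x ⁆ ⁅ y ⁆ z∈)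

  ∈-pairˡ : ∀ {x y : Fin n} → x ∈ pair x y
  ∈-pairˡ {x} = x∈p∪q⁺ (inj₁ (x∈⁅x⁆ x))

  ∈-pairʳ : ∀ {x y : Fin n} → y ∈ pair x y
  ∈-pairʳ {_} {y} = x∈p∪q⁺ (inj₂ (x∈⁅x⁆ y))

  pair-⊆ : ∀ {x y} {e : Subset n} → x ∈ e → y ∈ e → pair x y ⊆ˢ e
  pair-⊆ x∈ y∈ z∈ with ∈-pair⁻ z∈
  ... | inj₁ refl = x∈
  ... | inj₂ refl = y∈

∣pair∣≡2 : ∀ {n} {x y : Fin n} → x ≢ y → ∣ pair x y ∣ ≡ 2
∣pair∣≡2 {x = zero}  {zero}  x≢y = contradiction refl x≢y
∣pair∣≡2 {x = zero}  {suc y} _   = cong suc (trans (cong ∣_∣ (∪-identityˡ ⁅ y ⁆)) (∣⁅x⁆∣≡1 y))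
∣pair∣≡2 {x = suc x} {zero}  _   = cong suc (trans (cong ∣_∣ (∪-identityʳ ⁅ x ⁆)) (∣⁅x⁆∣≡1 x))
∣pair∣≡2 {x = suc x} {suc y} x≢y = ∣pair∣≡2 (x≢y ∘ cong suc)

-- If two equal edges had different first endpoints, each of these would be the second endpoint of
-- the other edge. Then `i` is `next j` and `j` is `next i`, which happens only in a cycle of length
-- 2.
cycle-edges-distinct : ∀ {n m E} {v : Fin m → Fin n} → IsCycle m E v →
                       Injective _≡_ _≡_ (λ i → pair (v i) (v (next i)))
cycle-edges-distinct {v = v} c {i} {j} eq
  with ∈-pair⁻ (subst (v i ∈_) eq ∈-pairˡ) | ∈-pair⁻ (subst (v j ∈_) (sym eq) ∈-pairˡ)
... | inj₁ vi≡vj  | _           = IsCycle.vertices-distinct c vi≡vj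
... | inj₂ _      | inj₁ vj≡vi  = sym (IsCycle.vertices-distinct c vj≡vi)
... | inj₂ vi≡vj⁺ | inj₂ vj≡vi⁺ = contradiction
  (sym (trans (vertices-distinct vi≡vj⁺) (cong next (vertices-distinct vj≡vi⁺))))
  (next∘next≢id atLeast3 i)
  where open IsCycle c

module _ {n : ℕ} where

  -- An inclusion-maximal matching in the bipartite graph joining each hyperedge to the pairs inside
  -- it. Sublists are used so that `matched` and `unmatched` inherit distinctness from `es`. In
  -- `length-split` the matched hyperedges are counted by their pairs.
  record MaximalMatching (es : List (Subset n)) : Set where
    field
      matching  : List (Subset n × Subset n)
      unmatched : List (Subset n)

    matched : List (Subset n)
    matched = map proj₁ matching

    graph : List (Subset n)
    graph = map proj₂ matching

    field
      matched-⊆      : matched ⊆ˡ es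
      unmatched-⊆    : unmatched ⊆ˡ es
      length-split   : length es ≡ length unmatched + length graph
      graph-uniform  : All (λ p → ∣ p ∣ ≡ 2) graph
      graph-distinct : Unique graph
      matched-⊇      : All (λ (e , p) → p ⊆ˢ e) matching
      maximal        : All (IsTriangle graph) unmatched

  -- Greedy choice from the end of the list: `e` is tested against the pairs taken by the hyperedges
  -- after it, and no earlier choice is revised.
  maximalMatching : ∀ es → All (λ e → ∣ e ∣ ≡ 3) es → MaximalMatching es
  maximalMatching [] [] = record
    { matching = [] ; unmatched = [] ; matched-⊆ = [] ; unmatched-⊆ = [] ; length-split = refl
    ; graph-uniform = [] ; graph-distinct = [] ; matched-⊇ = [] ; maximal = [] }
  maximalMatching (e ∷ es) (∣e∣≡3 ∷ uni) = extend
    (any? λ x → any? λ y → (x ∈? e) ×-dec (y ∈? e) ×-dec ¬? (x ≟ᶠ y) ×-dec ¬? (pair x y ∈ˡ? graph))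
    where
    open DecMembership (_≟ˢ_ {n}) using () renaming (_∈?_ to _∈ˡ?_)
    open MaximalMatching (maximalMatching es uni)

    extend : Dec (∃ λ x → ∃ λ y → x ∈ e × y ∈ e × x ≢ y × pair x y ∉ graph) →
             MaximalMatching (e ∷ es)
    extend (yes (x , y , x∈ , y∈ , x≢y , new)) = record
      { matching       = (e , pair x y) ∷ matching
      ; unmatched      = unmatched
      ; matched-⊆      = refl ∷ matched-⊆
      ; unmatched-⊆    = e ∷ʳ unmatched-⊆
      ; length-split   = trans (cong suc length-split) (sym (+-suc _ _))
      ; graph-uniform  = ∣pair∣≡2 x≢y ∷ graph-uniform
      ; graph-distinct = ¬Any⇒All¬ _ new ∷ graph-distinct
      ; matched-⊇      = pair-⊆ x∈ y∈ ∷ matched-⊇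
      -- The graph only grows, so its triangles remain triangles.
      ; maximal        = All.map (λ (size , adj) → size , λ x y p q r → there (adj x y p q r)) maximal
      }
    extend (no none) = record
      { matching       = matching
      ; unmatched      = e ∷ unmatched
      ; matched-⊆      = e ∷ʳ matched-⊆
      ; unmatched-⊆    = refl ∷ unmatched-⊆
      ; length-split   = cong suc length-split
      ; graph-uniform  = graph-uniform
      ; graph-distinct = graph-distinct
      ; matched-⊇      = matched-⊇
      -- The failed search says only that no pair in `e` is absent from the graph; decidable
      -- membership removes the double negation.
      ; maximal        = (∣e∣≡3 , λ x y x∈ y∈ x≢y → decidable-stable (pair x y ∈ˡ? graph)
                           λ new → none (x , y , x∈ , y∈ , x≢y , new)) ∷ maximal
      }

  module _ {es : List (Subset n)} (es! : Unique es) (M : MaximalMatching es) where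
    open MaximalMatching M

    cycle⇒bergeCycle : ∀ {m} → HasCycle m graph → HasBergeCycle m es
    cycle⇒bergeCycle {m} (v , c) = v , proj₁ ∘ link , record
      { positive          = ≤-trans (s≤s z≤n) atLeast3
      ; vertices-distinct = vertices-distinct
      -- Equal hyperedges have the same link, hence the same pair, and a cycle does not repeat an
      -- edge.
      ; edges-distinct    = λ {i} {j} eq → cycle-edges-distinct c
          (trans (link-pair i) (trans (cong proj₂ (link-injective i j eq)) (sym (link-pair j))))
      ; edge              = λ i → lookup matched-⊆ (∈-map⁺ proj₁ (link-∈ i))
      ; incident          = λ i {x} x∈ → All.lookup matched-⊇ (link-∈ i) (subst (x ∈_) (link-pair i) x∈)
      }
      where
      open IsCycle c
      link : Fin m → Subset n × Subset n
      link i = proj₁ (∈-map⁻ proj₂ (adjacent i))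
      link-∈ : ∀ i → link i ∈ˡ matching
      link-∈ i = proj₁ (proj₂ (∈-map⁻ proj₂ (adjacent i)))
      link-pair : ∀ i → pair (v i) (v (next i)) ≡ proj₂ (link i)
      link-pair i = proj₂ (proj₂ (∈-map⁻ proj₂ (adjacent i)))
      link-injective : ∀ i j → proj₁ (link i) ≡ proj₁ (link j) → link i ≡ link j
      link-injective i j = unique-map⇒injective proj₁ (AllPairs-resp-⊆ matched-⊆ es!)
        (link-∈ i) (link-∈ j)

    -- The unmatched hyperedges are distinct, and each appears among the subsets that
    -- `triangleCount` keeps.
    unmatched≤triangleCount : length unmatched ≤ triangleCount graph
    unmatched≤triangleCount = unique⇒length-mono (AllPairs-resp-⊆ unmatched-⊆ es!)
      λ {T} T∈ → ∈-filter⁺ (isTriangle? graph) (subsets-complete T) (All.lookup maximal T∈)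

-- For an extremal `H`, the single graph `G` is a competitor in both maxima on the right: its
-- triangles bound the unmatched hyperedges and its edges count the matched ones.
ex₃≤t+ex : ∀ m n → ex₃ n m ≤ t m n + ex n m
ex₃≤t+ex m n with ex₃-isMaximum n m
... | (H , noBerge , length≡ex₃) , _ = subst (_≤ t m n + ex n m)
  (trans (sym length-split) length≡ex₃)
  (+-mono-≤ (≤-trans (unmatched≤triangleCount (distinct H) M) (proj₂ (t-isMaximum m n) G noCycle))
            (proj₂ (ex-isMaximum n m) G noCycle))
  where
  M = maximalMatching (edges H) (uniform H)
  open MaximalMatching M
  G : Graph n
  G = record { edges = graph ; uniform = graph-uniform ; distinct = graph-distinct }
  noCycle = noBerge ∘ cycle⇒bergeCycle (distinct H) M

theorem2 : ∀ (k n : ℕ) → 2 ≤ k → 1 ≤ n →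
    ex₃ n (2 * k) ≤ t (2 * k) n + ex n (2 * k)
theorem2 k n _ _ = ex₃≤t+ex (2 * k) n
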